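{- Let $\Gamma=(Q,S,g,\tau)$ be a unit-seeded abstract tile assembly system (aTAM). Then there exists a unit-seeded directed surface chemical reaction network $\Gamma'$ on $\mathbb{Z}^2$ which simulates $\Gamma$.
   Context: aTAM: a tile has glue labels $(\sigma_N,\sigma_E,\sigma_S,\sigma_W)$ from an alphabet $\Sigma\ni\mathrm{null}$; $Q$ is a finite set of tile types (including the empty tile null), each available in unlimited supply. Glue strength $g(x,y)=\hat g(x)\in\mathbb{N}$ if $x=y$ and $0$ otherwise; temperature $\tau>0$. Configurations map $\mathbb{Z}^2$ to $Q$; the seed configuration $S$ has a seed tile $s$ at $(0,0)$ and null elsewhere. A tile $t$ may attach at an empty position $(x_0,y_0)$ of the current assembly if the sum of $g$ over its four sides against the abutting sides of the neighbouring tiles is $\ge\tau$; one step is one such attachment. Reachability $\mathcal{A}(\Gamma)$ is from $S$; terminal configurations $\mathcal{A}_*(\Gamma)$ are reachable, $\tau$-stable (binding graph min-cut $\ge\tau$) configurations from which no other configuration is reachable. Directed sCRN on $\mathbb{Z}^2$: finite species set, reactions unimolecular $A\to B$ or directed bimolecular $(A,B,C,D,d)$, $d\in\{N,E,S,W\}$, applicable when the $B$-cell is the neighbour of the $A$-cell in direction $d$, turning them into $C,D$. Unit-seeded: initial configuration is blank $\mathcal{O}$ everywhere except a seed species at one cell; no reaction has only $\mathcal{O}$ as reactant(s). Reachable/terminal sets as usual (terminal: reachable and no other configuration reachable from it). Simulation of $\mathcal{T}$ by $\mathcal{S}$ under a state representation function $\mathcal{R}:Q_\mathcal{S}\to Q_\mathcal{T}\cup\{\mathrm{UND}\}$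 (extended cellwise to $\mathcal{R}^*$, giving UND if any cell maps to UND): (1) $\{\mathcal{R}^*(\alpha'):\alpha'\in\mathcal{A}(\mathcal{S})\}$ equals $\mathcal{A}(\mathcal{T})$ apart from possibly UND, and $\{\mathcal{R}^*(\alpha'):\alpha'\in\mathcal{A}_*(\mathcal{S})\}=\mathcal{A}_*(\mathcal{T})$; (2) $\alpha'\to_\mathcal{S}\beta'$ for $\alpha',\beta'\in\mathcal{A}(\mathcal{S})$ implies $\mathcal{R}^*(\alpha')\to_\mathcal{T}\mathcal{R}^*(\beta')$ or one of them is UND; (3) for every $\alpha\in\mathcal{A}(\mathcal{T})$ there is nonempty $\Pi\subseteq\mathcal{A}(\mathcal{S})$ all mapping to $\alpha$ such that for every $\beta\in\mathcal{A}(\mathcal{T})$ with $\alpha\to\beta$: (a) each $\alpha'\in\Pi$ reaches some $\beta'$ with $\mathcal{R}^*(\beta')=\beta$; (b) every $\alpha''\in\mathcal{A}(\mathcal{S})$ with $\mathcal{R}^*(\alpha'')=\alpha$ that reaches some $\beta'$ with $\mathcal{R}^*(\beta')=\beta$ is reachable from some $\alpha'\in\Pi$. "Simulates" means this holds for some $\mathcal{R}$. -}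

module Defs where

open import Data.Nat using (ℕ; zero; suc; _+_; _≤_)
open import Data.Integer using (ℤ) renaming (_+_ to _+ℤ_; suc to sucℤ; pred to predℤ)
open import Data.Fin using (Fin; zero; suc)
open import Data.Fin.Properties using (_≟_)
open import Data.Bool using (Bool; true; false; if_then_else_)
open import Data.Maybe using (Maybe; just; nothing)
open import Data.List using (List; map)
open import Data.Nat.ListAction using (sum)
open import Data.List.Relation.Unary.All using (All)
open import Data.List.Relation.Unary.Unique.Propositional using (Unique)
open import Data.Product using (Σ; ∃; _×_; _,_)
open import Relation.Nullary using (¬_; does)
open import Relation.Binary.PropositionalEquality using (_≡_; _≢_)

Pos : Set
Pos = ℤ × ℤ

data Dir : Set where
  N E S W : Dir

opp : Dir → Dir
opp N = S
opp E = W
opp S = N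
opp W = E

move : Dir → Pos → Pos
move N (x , y) = (x , sucℤ y)
move E (x , y) = (sucℤ x , y)
move S (x , y) = (x , predℤ y)
move W (x , y) = (predℤ x , y)

origin : Pos
origin = (ℤ.pos 0 , ℤ.pos 0)

Conf : Set → Set
Conf A = Pos → A

_≗C_ : {A : Set} → Conf A → Conf A → Set
α ≗C β = ∀ p → α p ≡ β p

Updated : {A : Set} → Conf A → Pos → A → Conf A → Set
Updated α p a β = (β p ≡ a) × (∀ q → q ≢ p → β q ≡ α q)

Updated₂ : {A : Set} → Conf A → Pos → A → Pos → A → Conf A → Set
Updated₂ α p a p' b β =
  (β p ≡ a) × (β p' ≡ b) × (∀ q → q ≢ p → q ≢ p' → β q ≡ α q)

data Star {A : Set} (R : Conf A → Conf A → Set) : Conf A → Conf A → Set where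
  done : ∀ {α β} → α ≗C β → Star R α β
  step : ∀ {α β γ} → R α β → Star R β γ → Star R α γ

-- aTAM
-- Glue alphabet Σ = Fin (suc k), the null glue being zero.
-- Tile types Q = Fin (suc n), the empty tile null being zero.
-- A tile type is determined by its glues (glue is injective).

record aTAM : Set where
  field
    k n        : ℕ
    glue       : Fin (suc n) → Dir → Fin (suc k)
    glue-null  : ∀ d → glue zero d ≡ zero
    glue-inj   : ∀ t u → (∀ d → glue t d ≡ glue u d) → t ≡ u
    ĝ          : Fin (suc k) → ℕ
    ĝ-null     : ĝ zero ≡ 0
    τ          : ℕ
    τ-pos      : 1 ≤ τ
    seedTile   : Fin (suc n)

module aTAMDefs (Γ : aTAM) where
  open aTAM Γ

  Q : Set
  Q = Fin (suc n)

  nullT : Q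
  nullT = zero

  g : Fin (suc k) → Fin (suc k) → ℕ
  g x y = if does (x ≟ y) then ĝ x else 0

  TConf : Set
  TConf = Conf Q

  seedConf : TConf → Set
  seedConf α = Updated (λ _ → nullT) origin seedTile α

  bindStrength : TConf → Pos → Q → ℕ
  bindStrength α p t =
      g (glue t N) (glue (α (move N p)) S)
    + g (glue t E) (glue (α (move E p)) W)
    + g (glue t S) (glue (α (move S p)) N)
    + g (glue t W) (glue (α (move W p)) E)

  _⇒_ : TConf → TConf → Set
  α ⇒ β = Σ Pos λ p → Σ Q λ t →
    (α p ≡ nullT) × (t ≢ nullT) × (τ ≤ bindStrength α p t) × Updated α p t β

  _⇒⁼_ : TConf → TConf → Set
  α ⇒⁼ β = (α ≗C β) Data.Sum.⊎ (α ⇒ β)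
    where import Data.Sum

  _⇒*_ : TConf → TConf → Set
  _⇒*_ = Star _⇒_

  Reachable : TConf → Set
  Reachable α = Σ TConf λ σ → seedConf σ × (σ ⇒* α)

  edgeWeight : TConf → Pos × Dir → ℕ
  edgeWeight α (p , d) = g (glue (α p) d) (glue (α (move d p)) (opp d))

  Crossing : TConf → (Pos → Bool) → Pos × Dir → Set
  Crossing α C (p , d) =
    (α p ≢ nullT) × (α (move d p) ≢ nullT) × (C p ≡ true) × (C (move d p) ≡ false)

  -- τ-stable: every cut of the binding graph into two nonempty parts has
  -- total crossing weight ≥ τ (i.e. some finite set of distinct crossing
  -- edges already has weight ≥ τ)
  Stable : TConf → Set
  Stable α = ∀ (C : Pos → Bool) →
    (Σ Pos λ p → (α p ≢ nullT) × (C p ≡ true)) →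
    (Σ Pos λ p → (α p ≢ nullT) × (C p ≡ false)) →
    Σ (List (Pos × Dir)) λ L →
      Unique L × All (Crossing α C) L × (τ ≤ sum (map (edgeWeight α) L))

  Terminal : TConf → Set
  Terminal α = Reachable α × Stable α × (∀ β → α ⇒* β → β ≗C α)

-- Directed sCRN on ℤ²: species Fin (suc m), the blank species 𝒪 being zero

data Reaction (m : ℕ) : Set where
  uni : Fin (suc m) → Fin (suc m) → Reaction m
  bi  : Fin (suc m) → Fin (suc m) → Fin (suc m) → Fin (suc m) → Dir → Reaction m

record sCRN : Set where
  field
    m           : ℕ
    reactions   : List (Reaction m)
    seedSpecies : Fin (suc m)
    seedPos     : Pos

module sCRNDefs (Γ' : sCRN) where
  open sCRN Γ'
  open import Data.List.Membership.Propositional using (_∈_)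

  Sp : Set
  Sp = Fin (suc m)

  blank : Sp
  blank = zero

  SConf : Set
  SConf = Conf Sp

  initConf : SConf → Set
  initConf α = Updated (λ _ → blank) seedPos seedSpecies α

  Applies : Reaction m → SConf → SConf → Set
  Applies (uni A B) α β = Σ Pos λ p → (α p ≡ A) × Updated α p B β
  Applies (bi A B C D d) α β = Σ Pos λ p →
    (α p ≡ A) × (α (move d p) ≡ B) × Updated₂ α p C (move d p) D β

  _⇒_ : SConf → SConf → Set
  α ⇒ β = Σ (Reaction m) λ r → (r ∈ reactions) × Applies r α β

  _⇒*_ : SConf → SConf → Set
  _⇒*_ = Star _⇒_

  Reachable : SConf → Set
  Reachable α = Σ SConf λ σ → initConf σ × (σ ⇒* α)

  Terminal : SConf → Set
  Terminal α = Reachable α × (∀ β → α ⇒* β → β ≗C α)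

-- unit-seeded: no reaction has only 𝒪 as reactant(s)
-- (the unit seed itself is built into sCRN)
NotOnlyBlank : {m : ℕ} → Reaction m → Set
NotOnlyBlank (uni A B) = A ≢ zero
NotOnlyBlank (bi A B C D d) = ¬ ((A ≡ zero) × (B ≡ zero))

UnitSeeded : sCRN → Set
UnitSeeded Γ' = All NotOnlyBlank (sCRN.reactions Γ')

module Sim (Γ' : sCRN) (Γ : aTAM) where
  module T = aTAMDefs Γ
  module S = sCRNDefs Γ'

  -- a state representation function; nothing = UND
  RepFun : Set
  RepFun = S.Sp → Maybe T.Q

  MapsTo : RepFun → S.SConf → T.TConf → Set
  MapsTo R α' α = ∀ p → R (α' p) ≡ just (α p)

  Simulates : RepFun → Set₁
  Simulates R =
      (∀ α' → S.Reachable α' → ∀ α → MapsTo R α' α → T.Reachable α)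
    × (∀ α → T.Reachable α → Σ S.SConf λ α' → S.Reachable α' × MapsTo R α' α)
    × (∀ α' → S.Terminal α' → Σ T.TConf λ α → MapsTo R α' α × T.Terminal α)
    × (∀ α → T.Terminal α → Σ S.SConf λ α' → S.Terminal α' × MapsTo R α' α)
    × (∀ α' β' → S.Reachable α' → S.Reachable β' → α' S.⇒ β' →
         ∀ α β → MapsTo R α' α → MapsTo R β' β → α T.⇒⁼ β)
    × (∀ α → T.Reachable α →
         Σ (S.SConf → Set) λ Π →
             (Σ S.SConf Π)
           × (∀ α' → Π α' → S.Reachable α' × MapsTo R α' α)
           × (∀ β → T.Reachable β → α T.⇒ β →
                 (∀ α' → Π α' → Σ S.SConf λ β' → (α' S.⇒* β') × MapsTo R β' β)
               × (∀ α'' → S.Reachable α'' → MapsTo R α'' α →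
                    (Σ S.SConf λ β' → (α'' S.⇒* β') × MapsTo R β' β) →
                    Σ S.SConf λ α' → Π α' × (α' S.⇒* α''))))

SimulatesSys : sCRN → aTAM → Set₁
SimulatesSys Γ' Γ = Σ (Sim.RepFun Γ' Γ) λ R → Sim.Simulates Γ' Γ R

-- Each cell of the network holds either a tile or a vacant species that records,
-- slot by slot, the glues its four neighbours present to it. A tile writes its
-- glues into the facing slots of vacant neighbours (bimolecular "announce"
-- reactions), and a vacant cell turns into tile t (unimolecular "attach") when its
-- recorded glues bind t with strength at least τ. Every recorded glue is blank or
-- correct, so recorded strength never exceeds the true binding strength and each
-- network step is an aTAM attachment or changes no tile; conversely an aTAM
-- attachment is replayed by first letting the neighbours re-announce and then
-- attaching. From a saturated configuration (all slots correct) whose tiles admit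
-- no attachment nothing can change, which matches terminal assemblies. Reachable
-- aTAM assemblies are τ-stable by induction: a cut of the grown assembly either
-- also cuts the old one, or separates the new tile from all its neighbours, and
-- then its binding edges, of total strength at least τ, all cross the cut.
module Submission where

open import Defs
open import Data.Bool using (Bool; true; false; not)
import Data.Bool.Properties as Boolₚ
open import Data.Empty using (⊥-elim)
open import Data.Fin as Fin using (Fin; zero; suc; splitAt; join; combine; remQuot)
import Data.Fin.Properties as Finₚ
open import Data.Integer as ℤ using () renaming (suc to sucℤ; pred to predℤ)
import Data.Integer.Properties as ℤₚ
open import Data.List using (List; []; _∷_; _++_; map; filter; allFin; cartesianProduct)
open import Data.List.Membership.Propositional using (_∈_; lose)
import Data.List.Membership.Propositional.Properties as ∈ₚ
import Data.List.Properties as Listₚ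
open import Data.List.Relation.Unary.All as All using (All; []; _∷_)
import Data.List.Relation.Unary.All.Properties as Allₚ
open import Data.List.Relation.Unary.AllPairs using ([]; _∷_)
open import Data.List.Relation.Unary.Any using (Any; here; there; any?; satisfied)
open import Data.List.Relation.Unary.Any.Properties using (¬Any[])
open import Data.List.Relation.Unary.Unique.Propositional using (Unique)
import Data.List.Relation.Unary.Unique.Propositional.Properties as Uniqueₚ
open import Data.Maybe using (just)
open import Data.Maybe.Properties using (just-injective)
open import Data.Nat as ℕ using (ℕ; _+_; _*_; _≤_; _≤?_)
import Data.Nat.Properties as ℕₚ
open import Data.Nat.ListAction using (sum)
open import Data.Product using (Σ; _×_; _,_; proj₁; proj₂; map₂)
import Data.Product.Properties as Productₚ
open import Data.Sum using (_⊎_; inj₁; inj₂)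
open import Function using (_∘_)
open import Relation.Binary.Definitions using (DecidableEquality)
open import Relation.Binary.PropositionalEquality
open import Relation.Nullary using (¬_; Dec; yes; no; ¬?)
open import Relation.Nullary.Decidable using (decidable-stable; _×-dec_)

private
  i≢suc-i : ∀ i → i ≢ sucℤ i
  i≢suc-i _ = ℤₚ.i≢suc[i]

  pred-i<i : ∀ i → predℤ i ℤ.< i
  pred-i<i i = ℤₚ.suc[i]≤j⇒i<j (ℤₚ.≤-reflexive (ℤₚ.suc-pred i))

  i≢pred-i : ∀ i → i ≢ predℤ i
  i≢pred-i i eq = ℤₚ.<-irrefl (sym eq) (pred-i<i i)

  suc-i≢pred-i : ∀ i → sucℤ i ≢ predℤ i
  suc-i≢pred-i i eq = ℤₚ.<-asym (pred-i<i i) (subst (i ℤ.<_) eq (ℤₚ.suc[i]≤j⇒i<j ℤₚ.≤-refl))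

opp-involutive : ∀ d → opp (opp d) ≡ d
opp-involutive N = refl
opp-involutive E = refl
opp-involutive S = refl
opp-involutive W = refl

move-opp : ∀ d p → move (opp d) (move d p) ≡ p
move-opp N (x , y) = cong (x ,_) (ℤₚ.pred-suc y)
move-opp E (x , y) = cong (_, y) (ℤₚ.pred-suc x)
move-opp S (x , y) = cong (x ,_) (ℤₚ.suc-pred y)
move-opp W (x , y) = cong (_, y) (ℤₚ.suc-pred x)

move≢ : ∀ d p → move d p ≢ p
move≢ N (x , y) eq = i≢suc-i y (sym (cong proj₂ eq))
move≢ E (x , y) eq = i≢suc-i x (sym (cong proj₁ eq))
move≢ S (x , y) eq = i≢pred-i y (sym (cong proj₂ eq))
move≢ W (x , y) eq = i≢pred-i x (sym (cong proj₁ eq))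

move-injectiveˡ : ∀ d e p → move d p ≡ move e p → d ≡ e
move-injectiveˡ N N _ _ = refl
move-injectiveˡ E E _ _ = refl
move-injectiveˡ S S _ _ = refl
move-injectiveˡ W W _ _ = refl
move-injectiveˡ N E (x , y) eq = ⊥-elim (i≢suc-i x (cong proj₁ eq))
move-injectiveˡ N S (x , y) eq = ⊥-elim (suc-i≢pred-i y (cong proj₂ eq))
move-injectiveˡ N W (x , y) eq = ⊥-elim (i≢pred-i x (cong proj₁ eq))
move-injectiveˡ E N (x , y) eq = ⊥-elim (i≢suc-i x (sym (cong proj₁ eq)))
move-injectiveˡ E S (x , y) eq = ⊥-elim (i≢suc-i x (sym (cong proj₁ eq)))
move-injectiveˡ E W (x , y) eq = ⊥-elim (suc-i≢pred-i x (cong proj₁ eq))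
move-injectiveˡ S N (x , y) eq = ⊥-elim (suc-i≢pred-i y (sym (cong proj₂ eq)))
move-injectiveˡ S E (x , y) eq = ⊥-elim (i≢suc-i x (cong proj₁ eq))
move-injectiveˡ S W (x , y) eq = ⊥-elim (i≢pred-i x (cong proj₁ eq))
move-injectiveˡ W N (x , y) eq = ⊥-elim (i≢pred-i x (sym (cong proj₁ eq)))
move-injectiveˡ W E (x , y) eq = ⊥-elim (suc-i≢pred-i x (sym (cong proj₁ eq)))
move-injectiveˡ W S (x , y) eq = ⊥-elim (i≢pred-i x (sym (cong proj₁ eq)))

move⁻¹ : ∀ d {p q} → move d p ≡ q → p ≡ move (opp d) q
move⁻¹ d {p} refl = sym (move-opp d p)

_≟ₚ_ : DecidableEquality Pos
_≟ₚ_ = Productₚ.≡-dec ℤ._≟_ ℤ._≟_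

allDirs : List Dir
allDirs = N ∷ E ∷ S ∷ W ∷ []

∈-allDirs : ∀ d → d ∈ allDirs
∈-allDirs N = here refl
∈-allDirs E = there (here refl)
∈-allDirs S = there (there (here refl))
∈-allDirs W = there (there (there (here refl)))

allDirs-unique : Unique allDirs
allDirs-unique = ((λ ()) ∷ (λ ()) ∷ (λ ()) ∷ []) ∷ ((λ ()) ∷ (λ ()) ∷ []) ∷ ((λ ()) ∷ []) ∷ [] ∷ []

module _ {A : Set} where

  ≗-refl : {α : Conf A} → α ≗C α
  ≗-refl _ = refl

  ≗-sym : {α β : Conf A} → α ≗C β → β ≗C α
  ≗-sym eq p = sym (eq p)

  ≗-trans : {α β γ : Conf A} → α ≗C β → β ≗C γ → α ≗C γ
  ≗-trans eq eq′ p = trans (eq p) (eq′ p)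

  _[_↦_] : Conf A → Pos → A → Conf A
  (α [ p ↦ a ]) q with q ≟ₚ p
  ... | yes _ = a
  ... | no _ = α q

  ↦-here : ∀ α p (a : A) → (α [ p ↦ a ]) p ≡ a
  ↦-here α p a with p ≟ₚ p
  ... | yes _ = refl
  ... | no p≢p = ⊥-elim (p≢p refl)

  ↦-there : ∀ α {p q} (a : A) → q ≢ p → (α [ p ↦ a ]) q ≡ α q
  ↦-there α {p} {q} a q≢p with q ≟ₚ p
  ... | yes q≡p = ⊥-elim (q≢p q≡p)
  ... | no _ = refl

  ↦-updated : ∀ α p (a : A) → Updated α p a (α [ p ↦ a ])
  ↦-updated α p a = ↦-here α p a , λ q → ↦-there α a

  Updated-≗ : ∀ {α α′ β β′ : Conf A} {p a} → α ≗C α′ → Updated α p a β → Updated α′ p a β′ → β ≗C β′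
  Updated-≗ {p = p} eq (βp , βq) (β′p , β′q) x with x ≟ₚ p
  ... | yes refl = trans βp (sym β′p)
  ... | no x≢p = trans (βq x x≢p) (trans (eq x) (sym (β′q x x≢p)))

  Star-stuck : {R : Conf A → Conf A → Set} {α : Conf A} →
    (∀ β → ¬ R α β) → ∀ {γ} → Star R α γ → γ ≗C α
  Star-stuck stuck (done eq) = ≗-sym eq
  Star-stuck stuck (step r _) = ⊥-elim (stuck _ r)

  module StarProperties (R : Conf A → Conf A → Set)
         (R-resp : ∀ {α α′ β} → α ≗C α′ → R α β → R α′ β) where

    single : ∀ {α β} → R α β → Star R α β
    single r = step r (done ≗-refl)

    _◅◅_ : ∀ {α β γ} → Star R α β → Star R β γ → Star R α γ
    done eq ◅◅ done eq′ = done (≗-trans eq eq′)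
    done eq ◅◅ step r rs = step (R-resp (≗-sym eq) r) rs
    step r rs ◅◅ rs′ = step r (rs ◅◅ rs′)

    Star-idle : ∀ {α} → (∀ β → R α β → β ≗C α) → ∀ {β γ} → β ≗C α → Star R β γ → γ ≗C α
    Star-idle idle β≗α (done eq) = ≗-trans (≗-sym eq) β≗α
    Star-idle idle β≗α (step r rs) = Star-idle idle (idle _ (R-resp β≗α r)) rs

sum-filter : ∀ {A : Set} {P : A → Set} (P? : ∀ x → Dec (P x)) (f : A → ℕ) →
  (∀ x → ¬ P x → f x ≡ 0) → ∀ xs → sum (map f (filter P? xs)) ≡ sum (map f xs)
sum-filter P? f f≡0 [] = refl
sum-filter P? f f≡0 (x ∷ xs) with P? x
... | yes _ = cong (f x +_) (sum-filter P? f f≡0 xs)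
... | no ¬px = trans (sum-filter P? f f≡0 xs) (cong (_+ sum (map f xs)) (sym (f≡0 x ¬px)))

sum-allDirs : ∀ (f : Dir → ℕ) → sum (map f allDirs) ≡ f N + f E + f S + f W
sum-allDirs f = begin
  f N + (f E + (f S + (f W + 0))) ≡⟨ cong (λ x → f N + (f E + (f S + x))) (ℕₚ.+-identityʳ (f W)) ⟩
  f N + (f E + (f S + f W))       ≡⟨ ℕₚ.+-assoc (f N) (f E) (f S + f W) ⟨
  f N + f E + (f S + f W)         ≡⟨ ℕₚ.+-assoc (f N + f E) (f S) (f W) ⟨
  f N + f E + f S + f W           ∎
  where open ≡-Reasoning

-- Stability of reachable tile assemblies

module TileAssembly (Γ : aTAM) where
  open aTAM Γ
  open aTAMDefs Γ

  g-sym : ∀ x y → g x y ≡ g y x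
  g-sym x y with x Finₚ.≟ y | y Finₚ.≟ x
  ... | yes refl | yes _ = refl
  ... | yes refl | no y≢x = ⊥-elim (y≢x refl)
  ... | no x≢y | yes refl = ⊥-elim (x≢y refl)
  ... | no _ | no _ = refl

  g-zeroʳ : ∀ x → g x zero ≡ 0
  g-zeroʳ zero = ĝ-null
  g-zeroʳ (suc _) = refl

  facing : TConf → Pos → Dir → Fin (ℕ.suc k)
  facing α p d = glue (α (move d p)) (opp d)

  facing-null : ∀ {α p d} → α (move d p) ≡ nullT → facing α p d ≡ zero
  facing-null {d = d} eq = trans (cong (λ t → glue t (opp d)) eq) (glue-null (opp d))

  facing-≗ : ∀ {α β} → α ≗C β → ∀ p d → facing α p d ≡ facing β p d
  facing-≗ eq p d = cong (λ t → glue t (opp d)) (eq (move d p))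

  facing-opp : ∀ α p d → facing α (move d p) (opp d) ≡ glue (α p) d
  facing-opp α p d = cong₂ (λ x d′ → glue (α x) d′) (move-opp d p) (opp-involutive d)

  bindStrength-≗ : ∀ {α α′} → α ≗C α′ → ∀ p t → bindStrength α p t ≡ bindStrength α′ p t
  bindStrength-≗ eq p t rewrite eq (move N p) | eq (move E p) | eq (move S p) | eq (move W p) = refl

  ⇒-resp : ∀ {α α′ β β′} → α ≗C α′ → β ≗C β′ → α ⇒ β → α′ ⇒ β′
  ⇒-resp eqα eqβ (p , t , αp , t≢0 , τ≤ , βp , βq) =
    p , t , trans (sym (eqα p)) αp , t≢0 , subst (τ ≤_) (bindStrength-≗ eqα p t) τ≤ ,
    trans (sym (eqβ p)) βp , λ q q≢p → trans (sym (eqβ q)) (trans (βq q q≢p) (eqα q))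

  open StarProperties _⇒_ (λ eq → ⇒-resp eq ≗-refl)

  ⇒⁼-resp : ∀ {α α′ β β′} → α ≗C α′ → β ≗C β′ → α ⇒⁼ β → α′ ⇒⁼ β′
  ⇒⁼-resp eqα eqβ (inj₁ α≗β) = inj₁ (≗-trans (≗-sym eqα) (≗-trans α≗β eqβ))
  ⇒⁼-resp eqα eqβ (inj₂ α⇒β) = inj₂ (⇒-resp eqα eqβ α⇒β)

  reachable-≗ : ∀ {α β} → Reachable α → α ≗C β → Reachable β
  reachable-≗ (σ , seed , σ⇒*α) eq = σ , seed , σ⇒*α ◅◅ done eq

  reachable-⇒⁼ : ∀ {α β} → Reachable α → α ⇒⁼ β → Reachable β
  reachable-⇒⁼ α-reach (inj₁ eq) = reachable-≗ α-reach eq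
  reachable-⇒⁼ (σ , seed , σ⇒*α) (inj₂ α⇒β) = σ , seed , σ⇒*α ◅◅ single α⇒β

  Inert : TConf → Set
  Inert α = ∀ β → ¬ (α ⇒ β)

  ⇒-not-idle : ∀ {α β} → α ⇒ β → ¬ (β ≗C α)
  ⇒-not-idle (p , t , αp , t≢0 , _ , βp , _) β≗α = t≢0 (trans (sym βp) (trans (β≗α p) αp))

  final⇒inert : ∀ {α} → (∀ β → α ⇒* β → β ≗C α) → Inert α
  final⇒inert final β α⇒β = ⇒-not-idle α⇒β (final β (single α⇒β))

  inert-≗ : ∀ {α β} → Inert α → α ≗C β → Inert β
  inert-≗ inert eq γ β⇒γ = inert γ (⇒-resp (≗-sym eq) ≗-refl β⇒γ)

  HeavyCut : TConf → (Pos → Bool) → Set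
  HeavyCut α C = Σ (List (Pos × Dir)) λ L →
    Unique L × All (Crossing α C) L × (τ ≤ sum (map (edgeWeight α) L))

  heavy-transfer : ∀ {α β C} →
    (∀ e → Crossing α C e → Crossing β C e × (edgeWeight α e ≡ edgeWeight β e)) →
    HeavyCut α C → HeavyCut β C
  heavy-transfer transfer (L , unique , crossing , τ≤) =
    L , unique , All.map (proj₁ ∘ transfer _) crossing ,
    subst (τ ≤_) (cong sum (Listₚ.map-cong-local (All.map (proj₂ ∘ transfer _) crossing))) τ≤

  flip-edge : Pos × Dir → Pos × Dir
  flip-edge (p , d) = move d p , opp d

  flip-edge-involutive : ∀ e → flip-edge (flip-edge e) ≡ e
  flip-edge-involutive (p , d) = cong₂ _,_ (move-opp d p) (opp-involutive d)

  flip-edge-injective : ∀ {e e′} → flip-edge e ≡ flip-edge e′ → e ≡ e′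
  flip-edge-injective {e} {e′} eq =
    trans (sym (flip-edge-involutive e)) (trans (cong flip-edge eq) (flip-edge-involutive e′))

  edgeWeight-flip : ∀ α e → edgeWeight α (flip-edge e) ≡ edgeWeight α e
  edgeWeight-flip α (p , d) =
    trans (cong₂ (λ q d′ → g (glue (α (move d p)) (opp d)) (glue (α q) d′))
                 (move-opp d p) (opp-involutive d))
          (g-sym _ _)

  heavy-complement : ∀ {α C} → HeavyCut α (not ∘ C) → HeavyCut α C
  heavy-complement {α} {C} (L , unique , crossing , τ≤) =
    map flip-edge L , Uniqueₚ.map⁺ flip-edge-injective unique ,
    Allₚ.map⁺ (All.map flip-crossing crossing) ,
    subst (τ ≤_) weight τ≤
    where
    flip-crossing : ∀ {e} → Crossing α (not ∘ C) e → Crossing α C (flip-edge e)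
    flip-crossing {p , d} (αp , αq , Cp , Cq) =
      αq , subst (λ x → α x ≢ nullT) (sym (move-opp d p)) αp ,
      Boolₚ.not-injective Cq , subst (λ x → C x ≡ false) (sym (move-opp d p)) (Boolₚ.not-injective Cp)
    weight : sum (map (edgeWeight α) L) ≡ sum (map (edgeWeight α) (map flip-edge L))
    weight = cong sum (trans (sym (Listₚ.map-cong (edgeWeight-flip α) L)) (Listₚ.map-∘ L))

  stable-≗ : ∀ {α β} → Stable α → α ≗C β → Stable β
  stable-≗ {α} {β} stable eq C (x₁ , βx₁ , Cx₁) (x₂ , βx₂ , Cx₂) =
    heavy-transfer transfer
      (stable C (x₁ , βx₁ ∘ trans (sym (eq x₁)) , Cx₁) (x₂ , βx₂ ∘ trans (sym (eq x₂)) , Cx₂))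
    where
    transfer : ∀ e → Crossing α C e → Crossing β C e × (edgeWeight α e ≡ edgeWeight β e)
    transfer (x , d) (αx , αy , Cx , Cy) =
      (αx ∘ trans (eq x) , αy ∘ trans (eq (move d x)) , Cx , Cy) ,
      cong₂ g (cong (λ t → glue t d) (eq x)) (cong (λ t → glue t (opp d)) (eq (move d x)))

  seed-occupied⇒origin : ∀ {σ x} → seedConf σ → σ x ≢ nullT → x ≡ origin
  seed-occupied⇒origin {x = x} (_ , σ-off) σx with x ≟ₚ origin
  ... | yes x≡o = x≡o
  ... | no x≢o = ⊥-elim (σx (σ-off x x≢o))

  stable-seed : ∀ {σ} → seedConf σ → Stable σ
  stable-seed seed C (x₁ , σx₁ , Cx₁) (x₂ , σx₂ , Cx₂)
    with refl ← seed-occupied⇒origin seed σx₁ | refl ← seed-occupied⇒origin seed σx₂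
    with () ← trans (sym Cx₁) Cx₂

  -- Either an occupied neighbour of p lies on the side of p and the old stability
  -- applies, or all binding edges of the new tile cross the cut, weighing bindStrength ≥ τ.
  heavy-after-attach : ∀ {α β C} → Stable α → (α⇒β : α ⇒ β) → C (proj₁ α⇒β) ≡ true →
    Σ Pos (λ x → (β x ≢ nullT) × (C x ≡ false)) → HeavyCut β C
  heavy-after-attach {α} {β} {C} stable (p , t , αp , t≢0 , τ≤ , βp , βq) Cp (x₂ , βx₂ , Cx₂) =
    decide (any? linked? allDirs)
    where
    Occupied : Dir → Set
    Occupied d = β (move d p) ≢ nullT

    occupied? : ∀ d → Dec (Occupied d)
    occupied? d = ¬? (β (move d p) Fin.≟ nullT)

    Linked : Dir → Set
    Linked d = Occupied d × (C (move d p) ≡ true)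

    linked? : ∀ d → Dec (Linked d)
    linked? d = occupied? d ×-dec (C (move d p) Boolₚ.≟ true)

    α≢0⇒≢p : ∀ {x} → α x ≢ nullT → x ≢ p
    α≢0⇒≢p αx refl = αx αp

    from-α : ∀ e → Crossing α C e → Crossing β C e × (edgeWeight α e ≡ edgeWeight β e)
    from-α (x , d) (αx , αy , Cx , Cy) =
      (αx ∘ trans (sym (βx≡αx αx)) , αy ∘ trans (sym (βx≡αx αy)) , Cx , Cy) ,
      cong₂ g (cong (λ u → glue u d) (sym (βx≡αx αx))) (cong (λ u → glue u (opp d)) (sym (βx≡αx αy)))
      where
      βx≡αx : ∀ {x} → α x ≢ nullT → β x ≡ α x
      βx≡αx αx = βq _ (α≢0⇒≢p αx)

    to-α : ∀ {x} → x ≢ p → β x ≢ nullT → α x ≢ nullT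
    to-α x≢p βx αx = βx (trans (βq _ x≢p) αx)

    x₂≢p : x₂ ≢ p
    x₂≢p refl with () ← trans (sym Cp) Cx₂

    w : Dir → ℕ
    w d = g (glue t d) (facing α p d)

    edge≡w : ∀ d → edgeWeight β (p , d) ≡ w d
    edge≡w d = cong₂ g (cong (λ u → glue u d) βp) (cong (λ u → glue u (opp d)) (βq _ (move≢ d p)))

    w≡0 : ∀ d → ¬ Occupied d → w d ≡ 0
    w≡0 d unoccupied = trans (cong (g (glue t d)) (facing-null {α} {p} {d} αy≡0)) (g-zeroʳ _)
      where
      αy≡0 : α (move d p) ≡ nullT
      αy≡0 = trans (sym (βq _ (move≢ d p))) (decidable-stable (β (move d p) Fin.≟ nullT) unoccupied)

    star : List (Pos × Dir)
    star = map (p ,_) (filter occupied? allDirs)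

    star-weight : sum (map (edgeWeight β) star) ≡ bindStrength α p t
    star-weight = begin
      sum (map (edgeWeight β) star)            ≡⟨ cong sum (Listₚ.map-∘ occupied) ⟨
      sum (map (edgeWeight β ∘ (p ,_)) occupied) ≡⟨ cong sum (Listₚ.map-cong edge≡w occupied) ⟩
      sum (map w occupied)                     ≡⟨ sum-filter occupied? w w≡0 allDirs ⟩
      sum (map w allDirs)                      ≡⟨ sum-allDirs w ⟩
      bindStrength α p t                       ∎
      where
      open ≡-Reasoning
      occupied : List Dir
      occupied = filter occupied? allDirs

    decide : Dec (Any Linked allDirs) → HeavyCut β C
    decide (yes some) with d , βy , Cy ← satisfied some =
      heavy-transfer from-α (stable C (move d p , to-α (move≢ d p) βy , Cy) (x₂ , to-α x₂≢p βx₂ , Cx₂))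
    decide (no none) =
      star , Uniqueₚ.map⁺ (cong proj₂) (Uniqueₚ.filter⁺ occupied? allDirs-unique) ,
      Allₚ.map⁺ {f = p ,_} (All.map crossing (Allₚ.all-filter occupied? allDirs)) ,
      subst (τ ≤_) (sym star-weight) τ≤
      where
      crossing : ∀ {d} → Occupied d → Crossing β C (p , d)
      crossing {d} βy = (λ βp≡0 → t≢0 (trans (sym βp) βp≡0)) , βy , Cp ,
                        Boolₚ.¬-not (λ Cy → none (lose (∈-allDirs d) (βy , Cy)))

  stable-attach : ∀ {α β} → Stable α → α ⇒ β → Stable β
  stable-attach stable α⇒β@(p , _) C (x₁ , βx₁ , Cx₁) w₂ with C p in Cp
  ... | true = heavy-after-attach stable α⇒β Cp w₂
  ... | false = heavy-complement
    (heavy-after-attach {C = not ∘ C} stable α⇒β (cong not Cp) (x₁ , βx₁ , cong not Cx₁))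

  stable-⇒* : ∀ {α β} → Stable α → α ⇒* β → Stable β
  stable-⇒* stable (done eq) = stable-≗ stable eq
  stable-⇒* stable (step α⇒β β⇒*γ) = stable-⇒* (stable-attach stable α⇒β) β⇒*γ

  stable-reachable : ∀ {α} → Reachable α → Stable α
  stable-reachable (σ , seed , σ⇒*α) = stable-⇒* (stable-seed seed) σ⇒*α

module ReactionNetwork (Γ′ : sCRN) where
  open sCRNDefs Γ′

  ⇒-resp : ∀ {α α′ β} → α ≗C α′ → α ⇒ β → α′ ⇒ β
  ⇒-resp eq (uni A B , x∈ , p , αp , βp , βq) =
    uni A B , x∈ , p , trans (sym (eq p)) αp , βp , λ q q≢p → trans (βq q q≢p) (eq q)
  ⇒-resp eq (bi A B C D d , x∈ , p , αp , αq , βp , βq , βr) =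
    bi A B C D d , x∈ , p , trans (sym (eq p)) αp , trans (sym (eq (move d p))) αq , βp , βq ,
    λ r r≢p r≢q → trans (βr r r≢p r≢q) (eq r)

  open StarProperties _⇒_ ⇒-resp public

  reachable-⇒* : ∀ {α β} → Reachable α → α ⇒* β → Reachable β
  reachable-⇒* (σ , init , σ⇒*α) α⇒*β = σ , init , σ⇒*α ◅◅ α⇒*β

-- The simulating network

module Construction (Γ : aTAM) where
  open aTAM Γ
  open aTAMDefs Γ
  open TileAssembly Γ

  Glue : Set
  Glue = Fin (ℕ.suc k)

  -- what a vacant cell has been told about the glues its four neighbours present to it
  record Slots : Set where
    constructor slots
    field north east south west : Glue

  slot : Slots → Dir → Glue
  slot r N = Slots.north r
  slot r E = Slots.east r
  slot r S = Slots.south r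
  slot r W = Slots.west r

  _[_]≔_ : Slots → Dir → Glue → Slots
  r [ N ]≔ v = record r { north = v }
  r [ E ]≔ v = record r { east = v }
  r [ S ]≔ v = record r { south = v }
  r [ W ]≔ v = record r { west = v }

  slot-≔ : ∀ r d v e → (e ≡ d × slot (r [ d ]≔ v) e ≡ v) ⊎ (e ≢ d × slot (r [ d ]≔ v) e ≡ slot r e)
  slot-≔ r N v N = inj₁ (refl , refl)
  slot-≔ r E v E = inj₁ (refl , refl)
  slot-≔ r S v S = inj₁ (refl , refl)
  slot-≔ r W v W = inj₁ (refl , refl)
  slot-≔ r N v E = inj₂ ((λ ()) , refl)
  slot-≔ r N v S = inj₂ ((λ ()) , refl)
  slot-≔ r N v W = inj₂ ((λ ()) , refl)
  slot-≔ r E v N = inj₂ ((λ ()) , refl)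
  slot-≔ r E v S = inj₂ ((λ ()) , refl)
  slot-≔ r E v W = inj₂ ((λ ()) , refl)
  slot-≔ r S v N = inj₂ ((λ ()) , refl)
  slot-≔ r S v E = inj₂ ((λ ()) , refl)
  slot-≔ r S v W = inj₂ ((λ ()) , refl)
  slot-≔ r W v N = inj₂ ((λ ()) , refl)
  slot-≔ r W v E = inj₂ ((λ ()) , refl)
  slot-≔ r W v S = inj₂ ((λ ()) , refl)

  ≔-slot : ∀ r d → r [ d ]≔ slot r d ≡ r
  ≔-slot r N = refl
  ≔-slot r E = refl
  ≔-slot r S = refl
  ≔-slot r W = refl

  empty : Slots
  empty = slots zero zero zero zero

  slot-empty : ∀ d → slot empty d ≡ zero
  slot-empty N = refl
  slot-empty E = refl
  slot-empty S = refl
  slot-empty W = refl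

  around : TConf → Pos → Slots
  around α p = slots (facing α p N) (facing α p E) (facing α p S) (facing α p W)

  strength : Slots → Q → ℕ
  strength r t = g (glue t N) (slot r N) + g (glue t E) (slot r E)
               + g (glue t S) (slot r S) + g (glue t W) (slot r W)

  strength-empty : ∀ t → strength empty t ≡ 0
  strength-empty t
    rewrite g-zeroʳ (glue t N) | g-zeroʳ (glue t E) | g-zeroʳ (glue t S) | g-zeroʳ (glue t W) = refl

  _≼_ : Glue → Glue → Set
  v ≼ w = v ≡ zero ⊎ v ≡ w

  ≼-zero : ∀ {v} → v ≼ zero → v ≡ zero
  ≼-zero (inj₁ v≡0) = v≡0
  ≼-zero (inj₂ v≡0) = v≡0

  strength≤bindStrength : ∀ {r α p} → (∀ d → slot r d ≼ facing α p d) → ∀ t →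
    strength r t ≤ bindStrength α p t
  strength≤bindStrength {r} {α} {p} r≼ t =
    ℕₚ.+-mono-≤ (ℕₚ.+-mono-≤ (ℕₚ.+-mono-≤ (term N) (term E)) (term S)) (term W)
    where
    term : ∀ d → g (glue t d) (slot r d) ≤ g (glue t d) (facing α p d)
    term d with r≼ d
    ... | inj₁ v≡0 rewrite v≡0 | g-zeroʳ (glue t d) = ℕ.z≤n
    ... | inj₂ v≡w rewrite v≡w = ℕₚ.≤-refl

  data Cell : Set where
    vacant : Slots → Cell
    tile   : Fin n → Cell

  tileOf : Cell → Q
  tileOf (vacant _) = zero
  tileOf (tile i) = suc i

  toCell : Q → Cell
  toCell zero = vacant empty
  toCell (suc i) = tile i

  tileOf-toCell : ∀ t → tileOf (toCell t) ≡ t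
  tileOf-toCell zero = refl
  tileOf-toCell (suc i) = refl

  s : ℕ
  s = ℕ.suc k

  P : ℕ
  P = s * (s * (s * s))

  -- P + n is syntactically a successor, so Fin (suc m) is Fin (P + n)
  m : ℕ
  m = ℕ.pred (P + n)

  Species : Set
  Species = Fin (ℕ.suc m)

  -- abstract, so that the arithmetic hidden in P is never normalised by the type checker
  abstract
    encodeSlots : Slots → Fin P
    encodeSlots (slots a b c d) = combine a (combine b (combine c d))

    toSlots : Glue × Glue × Glue × Glue → Slots
    toSlots (a , b , c , d) = slots a b c d

    decodeSlots : Fin P → Slots
    decodeSlots x =
      toSlots (map₂ (map₂ (remQuot {s} s) ∘ remQuot {s} (s * s)) (remQuot {s} (s * (s * s)) x))

    decodeSlots-encodeSlots : ∀ r → decodeSlots (encodeSlots r) ≡ r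
    decodeSlots-encodeSlots (slots a b c d) = begin
      decodeSlots (combine a (combine b (combine c d)))
        ≡⟨ cong (toSlots ∘ map₂ (map₂ (remQuot {s} s) ∘ remQuot {s} (s * s)))
                (Finₚ.remQuot-combine {s} a _) ⟩
      toSlots (a , map₂ (remQuot {s} s) (remQuot {s} (s * s) (combine b (combine c d))))
        ≡⟨ cong (λ w → toSlots (a , map₂ (remQuot {s} s) w)) (Finₚ.remQuot-combine {s} b _) ⟩
      toSlots (a , b , remQuot {s} s (combine c d))
        ≡⟨ cong (λ w → toSlots (a , b , w)) (Finₚ.remQuot-combine {s} c d) ⟩
      slots a b c d ∎
      where open ≡-Reasoning

    encodeSlots-decodeSlots : ∀ x → encodeSlots (decodeSlots x) ≡ x
    encodeSlots-decodeSlots x = begin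
      combine a (combine b (combine c d)) ≡⟨ cong (combine a ∘ combine b) (Finₚ.combine-remQuot {s} s z) ⟩
      combine a (combine b z)             ≡⟨ cong (combine a) (Finₚ.combine-remQuot {s} (s * s) y) ⟩
      combine a y                         ≡⟨ Finₚ.combine-remQuot {s} (s * (s * s)) x ⟩
      x                                   ∎
      where
      open ≡-Reasoning
      y : Fin (s * (s * s))
      y = proj₂ (remQuot {s} (s * (s * s)) x)
      z : Fin (s * s)
      z = proj₂ (remQuot {s} (s * s) y)
      a b c d : Glue
      a = proj₁ (remQuot {s} (s * (s * s)) x)
      b = proj₁ (remQuot {s} (s * s) y)
      c = proj₁ (remQuot {s} s z)
      d = proj₂ (remQuot {s} s z)

    toSum : Cell → Fin P ⊎ Fin n
    toSum (vacant r) = inj₁ (encodeSlots r)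
    toSum (tile i) = inj₂ i

    fromSum : Fin P ⊎ Fin n → Cell
    fromSum (inj₁ x) = vacant (decodeSlots x)
    fromSum (inj₂ i) = tile i

    code : Cell → Species
    code c = join P n (toSum c)

    cell : Species → Cell
    cell x = fromSum (splitAt P x)

    cell-code : ∀ c → cell (code c) ≡ c
    cell-code c = trans (cong fromSum (Finₚ.splitAt-join P n (toSum c))) (fromSum-toSum c)
      where
      fromSum-toSum : ∀ c → fromSum (toSum c) ≡ c
      fromSum-toSum (vacant r) = cong vacant (decodeSlots-encodeSlots r)
      fromSum-toSum (tile i) = refl

    code-cell : ∀ x → code (cell x) ≡ x
    code-cell x = trans (cong (join P n) (toSum-fromSum (splitAt P x))) (Finₚ.join-splitAt P n x)
      where
      toSum-fromSum : ∀ u → toSum (fromSum u) ≡ u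
      toSum-fromSum (inj₁ y) = cong inj₁ (encodeSlots-decodeSlots y)
      toSum-fromSum (inj₂ i) = refl

    code-empty : code (vacant empty) ≡ zero
    code-empty = refl

  code-injective : ∀ {c c′} → code c ≡ code c′ → c ≡ c′
  code-injective {c} {c′} eq = trans (sym (cell-code c)) (trans (cong cell eq) (cell-code c′))

  cell-at : ∀ {x c} → x ≡ code c → cell x ≡ c
  cell-at {c = c} refl = cell-code c

  code-at : ∀ {x c} → cell x ≡ c → x ≡ code c
  code-at {x} refl = sym (code-cell x)

  vacant≢tile : ∀ {x r i} → x ≡ vacant r → x ≢ tile i
  vacant≢tile refl ()

  vacant-injective : ∀ {x r r′} → x ≡ vacant r → x ≡ vacant r′ → r ≡ r′
  vacant-injective refl refl = refl

  data Rule : Reaction m → Set where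
    attach   : ∀ r i → τ ≤ strength r (suc i) → Rule (uni (code (vacant r)) (code (tile i)))
    announce : ∀ i r d → Rule (bi (code (tile i)) (code (vacant r))
                                  (code (tile i)) (code (vacant (r [ opp d ]≔ glue (suc i) d))) d)

  allSlots : List Slots
  allSlots = map decodeSlots (allFin P)

  ∈-allSlots : ∀ r → r ∈ allSlots
  ∈-allSlots r =
    subst (_∈ allSlots) (decodeSlots-encodeSlots r) (∈ₚ.∈-map⁺ decodeSlots (∈ₚ.∈-allFin (encodeSlots r)))

  attachable? : (ri : Slots × Fin n) → Dec (τ ≤ strength (proj₁ ri) (suc (proj₂ ri)))
  attachable? (r , i) = τ ≤? strength r (suc i)

  attachments : List (Slots × Fin n)
  attachments = filter attachable? (cartesianProduct allSlots (allFin n))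

  announcements : List (Fin n × Slots × Dir)
  announcements = cartesianProduct (allFin n) (cartesianProduct allSlots allDirs)

  attachReaction : Slots × Fin n → Reaction m
  attachReaction (r , i) = uni (code (vacant r)) (code (tile i))

  announceReaction : Fin n × Slots × Dir → Reaction m
  announceReaction (i , r , d) =
    bi (code (tile i)) (code (vacant r)) (code (tile i)) (code (vacant (r [ opp d ]≔ glue (suc i) d))) d

  reactions : List (Reaction m)
  reactions = map attachReaction attachments ++ map announceReaction announcements

  rule⇒∈ : ∀ {x} → Rule x → x ∈ reactions
  rule⇒∈ (attach r i τ≤) = ∈ₚ.∈-++⁺ˡ (∈ₚ.∈-map⁺ attachReaction
    (∈ₚ.∈-filter⁺ attachable?
      (∈ₚ.∈-cartesianProduct⁺ (∈-allSlots r) (∈ₚ.∈-allFin i)) τ≤))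
  rule⇒∈ (announce i r d) = ∈ₚ.∈-++⁺ʳ (map attachReaction attachments) (∈ₚ.∈-map⁺ announceReaction
    (∈ₚ.∈-cartesianProduct⁺ (∈ₚ.∈-allFin i) (∈ₚ.∈-cartesianProduct⁺ (∈-allSlots r) (∈-allDirs d))))

  ∈⇒rule : ∀ {x} → x ∈ reactions → Rule x
  ∈⇒rule x∈ with ∈ₚ.∈-++⁻ (map attachReaction attachments) x∈
  ... | inj₁ x∈₁ with (r , i) , ri∈ , refl ← ∈ₚ.∈-map⁻ attachReaction x∈₁ =
    attach r i (proj₂ (∈ₚ.∈-filter⁻ attachable? {xs = cartesianProduct allSlots (allFin n)} ri∈))
  ... | inj₂ x∈₂ with (i , r , d) , _ , refl ← ∈ₚ.∈-map⁻ announceReaction x∈₂ = announce i r d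

  network : sCRN
  network = record
    { m = m ; reactions = reactions ; seedSpecies = code (toCell seedTile) ; seedPos = origin }

  network-unitSeeded : UnitSeeded network
  network-unitSeeded = All.tabulate (not-only-blank ∘ ∈⇒rule)
    where
    not-only-blank : ∀ {x} → Rule x → NotOnlyBlank x
    not-only-blank (attach r i τ≤) r≡blank
      with refl ← code-injective {vacant r} {vacant empty} (trans r≡blank (sym code-empty)) =
      ℕₚ.<⇒≱ τ-pos (subst (τ ≤_) (strength-empty (suc i)) τ≤)
    not-only-blank (announce i r d) (i≡blank , _) =
      vacant≢tile (cell-at (sym code-empty)) (cell-at (sym i≡blank))

  module Net = sCRNDefs network
  open ReactionNetwork network using (single; _◅◅_; Star-idle; reachable-⇒*)

  SConf : Set
  SConf = Net.SConf

  Attaches : Pos → Slots → Fin n → SConf → SConf → Set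
  Attaches p r i α β =
    (τ ≤ strength r (suc i)) × (cell (α p) ≡ vacant r) × Updated α p (code (tile i)) β

  Announces : Pos → Dir → Fin n → Slots → SConf → SConf → Set
  Announces p d i r α β = (cell (α p) ≡ tile i) × (cell (α (move d p)) ≡ vacant r) ×
    Updated₂ α p (code (tile i)) (move d p) (code (vacant (r [ opp d ]≔ glue (suc i) d))) β

  data Step (α β : SConf) : Set where
    attaching  : ∀ {p r i} → Attaches p r i α β → Step α β
    announcing : ∀ {p d i r} → Announces p d i r α β → Step α β

  announcer-after : ∀ {p d i r α β} → Announces p d i r α β → cell (β p) ≡ tile i
  announcer-after (_ , _ , βp , _) = cell-at βp

  listener-after : ∀ {p d i r α β} → Announces p d i r α β →
    cell (β (move d p)) ≡ vacant (r [ opp d ]≔ glue (suc i) d)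
  listener-after (_ , _ , _ , βq , _) = cell-at βq

  rule-step : ∀ {x α β} → Rule x → Net.Applies x α β → Step α β
  rule-step (attach r i τ≤) (p , αp , upd) = attaching (τ≤ , cell-at αp , upd)
  rule-step (announce i r d) (p , αp , αq , upd) = announcing (cell-at αp , cell-at αq , upd)

  step-view : ∀ {α β} → α Net.⇒ β → Step α β
  step-view (x , x∈ , applies) = rule-step (∈⇒rule x∈) applies

  attaches⇒ : ∀ {p r i α β} → Attaches p r i α β → α Net.⇒ β
  attaches⇒ {p} {r} {i} (τ≤ , αp , upd) = _ , rule⇒∈ (attach r i τ≤) , p , code-at αp , upd

  announces⇒ : ∀ {p d i r α β} → Announces p d i r α β → α Net.⇒ β
  announces⇒ {p} {d} {i} {r} (αp , αq , upd) =
    _ , rule⇒∈ (announce i r d) , p , code-at αp , code-at αq , upd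

  attach-↦ : ∀ {p r i α} → τ ≤ strength r (suc i) → cell (α p) ≡ vacant r →
    Attaches p r i α (α [ p ↦ code (tile i) ])
  attach-↦ {α = α} τ≤ αp = τ≤ , αp , ↦-updated α _ _

  announce-↦ : ∀ {p d i r α t} → cell (α p) ≡ tile i → cell (α t) ≡ vacant r → move d p ≡ t →
    Announces p d i r α (α [ t ↦ code (vacant (r [ opp d ]≔ glue (suc i) d)) ])
  announce-↦ {p} {d} {i} {r} {α} αp αt refl =
    αp , αt , trans (↦-there α D (move≢ d p ∘ sym)) (code-at αp) , ↦-here α (move d p) D ,
    λ q _ q≢t → ↦-there α D q≢t
    where
    D : Species
    D = code (vacant (r [ opp d ]≔ glue (suc i) d))

  shape : SConf → TConf
  shape α p = tileOf (cell (α p))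

  shape-≗ : ∀ {α β} → α ≗C β → shape α ≗C shape β
  shape-≗ eq p = cong (tileOf ∘ cell) (eq p)

  shape-updated : ∀ {α β p c} → Updated α p (code c) β → Updated (shape α) p (tileOf c) (shape β)
  shape-updated (βp , βq) = cong tileOf (cell-at βp) , λ q q≢p → cong (tileOf ∘ cell) (βq q q≢p)

  announce-shape : ∀ {p d i r α β} → Announces p d i r α β → shape β ≗C shape α
  announce-shape {p} {d} announcement@(αp , αq , _ , _ , β≡α) x with x ≟ₚ p | x ≟ₚ move d p
  ... | yes refl | _ = cong tileOf (trans (announcer-after announcement) (sym αp))
  ... | no _ | yes refl = trans (cong tileOf (listener-after announcement)) (sym (cong tileOf αq))
  ... | no x≢p | no x≢q = cong (tileOf ∘ cell) (β≡α x x≢p x≢q)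

  announced-facing : ∀ {α p d i} → cell (α p) ≡ tile i →
    facing (shape α) (move d p) (opp d) ≡ glue (suc i) d
  announced-facing {α} {p} {d} αp =
    trans (facing-opp (shape α) p d) (cong (λ c → glue (tileOf c) d) αp)

  -- Soundness of recorded glues

  Sound : SConf → Set
  Sound α = ∀ {p r} → cell (α p) ≡ vacant r → ∀ d → slot r d ≼ facing (shape α) p d

  sound-≗ : ∀ {α β} → Sound α → α ≗C β → Sound β
  sound-≗ sound eq {p} {r} βp d =
    subst (slot r d ≼_) (facing-≗ (shape-≗ eq) p d) (sound (trans (cong cell (eq p)) βp) d)

  attach-sound : ∀ {p r i α β} → Sound α → Attaches p r i α β → Sound β × (shape α ⇒ shape β)
  attach-sound {p} {r} {i} {α} {β} sound (τ≤ , αp , βp , β≡α) = sound-β , attachment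
    where
    attachment : shape α ⇒ shape β
    attachment = p , suc i , cong tileOf αp , (λ ()) ,
      ℕₚ.≤-trans τ≤ (strength≤bindStrength {α = shape α} {p} (sound αp) (suc i)) ,
      shape-updated {c = tile i} (βp , β≡α)

    sound-β : Sound β
    sound-β {y} {r′} βy d with y ≟ₚ p
    ... | yes refl = ⊥-elim (vacant≢tile βy (cell-at βp))
    ... | no y≢p with move d y ≟ₚ p | sound (trans (cong cell (sym (β≡α y y≢p))) βy) d
    ...   | yes refl | αy-sound =
            inj₁ (≼-zero (subst (slot r′ d ≼_) (facing-null {shape α} {y} {d} (cong tileOf αp)) αy-sound))
    ...   | no z≢p | αy-sound =
            subst (slot r′ d ≼_) (cong (λ x → glue (tileOf (cell x)) (opp d)) (sym (β≡α _ z≢p))) αy-sound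

  announce-sound : ∀ {p d i r α β} → Sound α → Announces p d i r α β → Sound β
  announce-sound {p} {d} {i} {r} {α} {β} sound announcement@(αp , αq , βp , βq , β≡α) = sound-β
    where
    same : shape β ≗C shape α
    same = announce-shape announcement

    sound-β : Sound β
    sound-β {y} βy e with y ≟ₚ move d p | y ≟ₚ p
    ... | yes refl | _ with vacant-injective βy (listener-after announcement)
                           | slot-≔ r (opp d) (glue (suc i) d) e
    ...   | refl | inj₁ (refl , slot≡) =
            inj₂ (trans slot≡ (sym (announced-facing {β} {p} {d} (announcer-after announcement))))
    ...   | refl | inj₂ (_ , slot≡) =
            subst (_≼ facing (shape β) (move d p) e) (sym slot≡)
              (subst (slot r e ≼_) (sym (facing-≗ same (move d p) e)) (sound αq e))
    sound-β βy e | no y≢q | yes refl = ⊥-elim (vacant≢tile βy (announcer-after announcement))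
    sound-β {y} {r′} βy e | no y≢q | no y≢p =
      subst (slot r′ e ≼_) (sym (facing-≗ same y e))
        (sound (trans (cong cell (sym (β≡α y y≢p y≢q))) βy) e)

  sound-⇒ : ∀ {α β} → Sound α → α Net.⇒ β → Sound β × (shape α ⇒⁼ shape β)
  sound-⇒ sound α⇒β with step-view α⇒β
  ... | attaching attachment with attach-sound sound attachment
  ...   | sound-β , α⇒β′ = sound-β , inj₂ α⇒β′
  sound-⇒ sound α⇒β | announcing announcement =
    announce-sound sound announcement , inj₁ (≗-sym (announce-shape announcement))

  sound-⇒* : ∀ {α β} → Sound α → α Net.⇒* β → Sound β
  sound-⇒* sound (done eq) = sound-≗ sound eq
  sound-⇒* sound (step α⇒β β⇒*γ) = sound-⇒* (proj₁ (sound-⇒ sound α⇒β)) β⇒*γ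

  shape-reachable-⇒* : ∀ {α β} → Sound α → Reachable (shape α) → α Net.⇒* β → Reachable (shape β)
  shape-reachable-⇒* sound reach (done eq) = reachable-≗ reach (shape-≗ eq)
  shape-reachable-⇒* sound reach (step α⇒β β⇒*γ) with sound-⇒ sound α⇒β
  ... | sound-β , shape⇒⁼ = shape-reachable-⇒* sound-β (reachable-⇒⁼ reach shape⇒⁼) β⇒*γ

  toCell-vacant : ∀ t {r} → toCell t ≡ vacant r → r ≡ empty
  toCell-vacant zero refl = refl

  initial-slot : ∀ {σ y r} → Net.initConf σ → cell (σ y) ≡ vacant r → ∀ e → slot r e ≡ zero
  initial-slot {σ} {y} (σo , σ-off) σy e with y ≟ₚ origin
  ... | yes refl rewrite toCell-vacant seedTile (trans (sym (cell-at σo)) σy) = slot-empty e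
  ... | no y≢o rewrite vacant-injective σy (cell-at (trans (σ-off y y≢o) (sym code-empty))) = slot-empty e

  initial-sound : ∀ {σ} → Net.initConf σ → Sound σ
  initial-sound init σy e = inj₁ (initial-slot init σy e)

  initial-seed : ∀ {σ} → Net.initConf σ → seedConf (shape σ)
  initial-seed (σo , σ-off) =
    trans (cong tileOf (cell-at σo)) (tileOf-toCell seedTile) ,
    λ q q≢o → cong tileOf (cell-at (trans (σ-off q q≢o) (sym code-empty)))

  reachable⇒sound : ∀ {α} → Net.Reachable α → Sound α
  reachable⇒sound (σ , init , σ⇒*α) = sound-⇒* (initial-sound init) σ⇒*α

  shape-reachable : ∀ {α} → Net.Reachable α → Reachable (shape α)
  shape-reachable (σ , init , σ⇒*α) =
    shape-reachable-⇒* (initial-sound init) (shape σ , initial-seed init , done ≗-refl) σ⇒*α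

  -- Replaying aTAM attachments

  AgreeOff : Pos → SConf → SConf → Set
  AgreeOff p β α = ∀ x → x ≢ p → β x ≡ α x

  Refreshing : SConf → Pos → Slots → Set
  Refreshing γ p r = Σ SConf λ γ′ → γ Net.⇒* γ′ × AgreeOff p γ′ γ × cell (γ′ p) ≡ vacant r

  refresh : ∀ {γ p r} → Sound γ → cell (γ p) ≡ vacant r → ∀ d →
    Refreshing γ p (r [ d ]≔ facing (shape γ) p d)
  refresh {γ} {p} {r} sound γp d with cell (γ (move d p)) in γq
  ... | tile j = γ [ p ↦ code (vacant r′) ] ,
      single (announces⇒ (announce-↦ {d = opp d} γq γp (move-opp d p))) ,
      (λ x → ↦-there γ _) ,
      trans (cell-at (↦-here γ p (code (vacant r′)))) (cong vacant r′≡)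
    where
    r′ : Slots
    r′ = r [ opp (opp d) ]≔ glue (suc j) (opp d)
    r′≡ : r′ ≡ r [ d ]≔ glue (suc j) (opp d)
    r′≡ = cong (λ e → r [ e ]≔ glue (suc j) (opp d)) (opp-involutive d)
  ... | vacant _ = γ , done ≗-refl , (λ _ _ → refl) , trans γp (cong vacant (sym r≡))
    where
    slot≡0 : slot r d ≡ zero
    slot≡0 =
      ≼-zero (subst (slot r d ≼_) (facing-null {shape γ} {p} {d} (cong tileOf γq)) (sound γp d))
    r≡ : r [ d ]≔ glue zero (opp d) ≡ r
    r≡ = trans (cong (r [ d ]≔_) (trans (glue-null (opp d)) (sym slot≡0))) (≔-slot r d)

  refreshed : TConf → Pos → Slots → List Dir → Slots
  refreshed f p r [] = r
  refreshed f p r (d ∷ ds) = refreshed f p r ds [ d ]≔ facing f p d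

  refresh-many : ∀ {γ p r} → Sound γ → cell (γ p) ≡ vacant r → ∀ ds →
    Refreshing γ p (refreshed (shape γ) p r ds)
  refresh-many sound γp [] = _ , done ≗-refl , (λ _ _ → refl) , γp
  refresh-many {γ} {p} {r} sound γp (d ∷ ds) with refresh-many sound γp ds
  ... | γ₁ , γ⇒*γ₁ , γ₁≈γ , γ₁p with refresh (sound-⇒* sound γ⇒*γ₁) γ₁p d
  ...   | γ₂ , γ₁⇒*γ₂ , γ₂≈γ₁ , γ₂p =
    γ₂ , γ⇒*γ₁ ◅◅ γ₁⇒*γ₂ , (λ x x≢p → trans (γ₂≈γ₁ x x≢p) (γ₁≈γ x x≢p)) ,
    subst (λ v → cell (γ₂ p) ≡ vacant (refreshed (shape γ) p r ds [ d ]≔ v)) facing≡ γ₂p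
    where
    facing≡ : facing (shape γ₁) p d ≡ facing (shape γ) p d
    facing≡ = cong (λ x → glue (tileOf (cell x)) (opp d)) (γ₁≈γ (move d p) (move≢ d p))

  simulate-attach : ∀ {α′ α β} → Sound α′ → shape α′ ≗C α → (α⇒β : α ⇒ β) →
    Σ (Fin n) λ i → Σ SConf λ β′ →
      (α′ Net.⇒* β′) × Updated α′ (proj₁ α⇒β) (code (tile i)) β′ × (shape β′ ≗C β)
  simulate-attach sound eq (p , zero , _ , t≢0 , _) = ⊥-elim (t≢0 refl)
  simulate-attach {α′} sound eq (p , suc i , αp , _ , τ≤ , βupd) with cell (α′ p) in α′p
  ... | tile _ with () ← trans (sym (cong tileOf α′p)) (trans (eq p) αp)
  -- refreshed (shape α′) p r (W ∷ S ∷ E ∷ N ∷ []) is definitionally around (shape α′) p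
  ... | vacant r with refresh-many sound α′p (W ∷ S ∷ E ∷ N ∷ [])
  ...   | γ , α′⇒*γ , γ≈α′ , γp =
    i , β′ , α′⇒*γ ◅◅ single (attaches⇒ (attach-↦ τ≤′ γp)) , upd ,
    Updated-≗ eq (shape-updated {c = tile i} upd) βupd
    where
    β′ : SConf
    β′ = γ [ p ↦ code (tile i) ]
    τ≤′ : τ ≤ strength (around (shape α′) p) (suc i)
    τ≤′ = subst (τ ≤_) (sym (bindStrength-≗ eq p (suc i))) τ≤
    upd : Updated α′ p (code (tile i)) β′
    upd = ↦-here γ p _ , λ x x≢p → trans (↦-there γ _ x≢p) (γ≈α′ x x≢p)

  simulate-step : ∀ {α′ α β} → Sound α′ → shape α′ ≗C α → α ⇒ β →
    Σ SConf λ β′ → (α′ Net.⇒* β′) × (shape β′ ≗C β)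
  simulate-step sound eq α⇒β with simulate-attach sound eq α⇒β
  ... | _ , β′ , α′⇒*β′ , _ , shape-β′ = β′ , α′⇒*β′ , shape-β′

  -- Saturated representatives and terminal configurations

  Saturated : SConf → Set
  Saturated α = ∀ {p r} → cell (α p) ≡ vacant r → ∀ d → slot r d ≡ facing (shape α) p d

  -- saturated, except perhaps for the slots facing p from directions (seen from p) outside ds
  SaturatedExcept : SConf → Pos → List Dir → Set
  SaturatedExcept α p ds = ∀ {y r} → cell (α y) ≡ vacant r → ∀ e →
    (move e y ≡ p → opp e ∈ ds) → slot r e ≡ facing (shape α) y e

  saturated⇒sound : ∀ {α} → Saturated α → Sound α
  saturated⇒sound saturated αp d = inj₂ (saturated αp d)

  saturatedExcept-attach : ∀ {α β p i} → Saturated α → Updated α p (code (tile i)) β →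
    SaturatedExcept β p []
  saturatedExcept-attach {α} {β} {p} saturated (βp , β≡α) {y} βy e away with y ≟ₚ p
  ... | yes refl = ⊥-elim (vacant≢tile βy (cell-at βp))
  ... | no y≢p = trans (saturated (trans (cong cell (sym (β≡α y y≢p))) βy) e)
                       (cong (λ x → glue (tileOf (cell x)) (opp e)) (sym (β≡α _ (¬Any[] ∘ away))))

  announce-saturating : ∀ {γ p ds i} → SaturatedExcept γ p ds → cell (γ p) ≡ tile i → ∀ d →
    Σ SConf λ γ′ → (γ Net.⇒* γ′) × SaturatedExcept γ′ p (d ∷ ds) ×
                   (shape γ′ ≗C shape γ) × (cell (γ′ p) ≡ tile i)
  announce-saturating {γ} {p} {ds} {i} saturated γp d with cell (γ (move d p)) in γq
  ... | tile _ = γ , done ≗-refl , saturated′ , ≗-refl , γp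
    where
    saturated′ : SaturatedExcept γ p (d ∷ ds)
    saturated′ {y} γy e toward = saturated γy e (λ z≡p → earlier z≡p (toward z≡p))
      where
      earlier : move e y ≡ p → opp e ∈ d ∷ ds → opp e ∈ ds
      earlier z≡p (here refl) = ⊥-elim (vacant≢tile γy (trans (cong (cell ∘ γ) (move⁻¹ e z≡p)) γq))
      earlier _ (there e∈ds) = e∈ds
  ... | vacant r = γ′ , single (announces⇒ announcement) , saturated′ , same ,
                   trans (cong cell (↦-there γ _ (move≢ d p ∘ sym))) γp
    where
    γ′ : SConf
    γ′ = γ [ move d p ↦ code (vacant (r [ opp d ]≔ glue (suc i) d)) ]
    announcement : Announces p d i r γ γ′
    announcement = announce-↦ γp γq refl
    same : shape γ′ ≗C shape γ
    same = announce-shape announcement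
    saturated′ : SaturatedExcept γ′ p (d ∷ ds)
    saturated′ {y} {r′} γ′y e toward with move d p ≟ₚ y
    ... | yes refl with vacant-injective γ′y (listener-after announcement)
                      | slot-≔ r (opp d) (glue (suc i) d) e
    ...   | refl | inj₁ (refl , slot≡) =
            trans slot≡ (sym (announced-facing {γ′} {p} {d} (announcer-after announcement)))
    ...   | refl | inj₂ (e≢opp-d , slot≡) =
            trans slot≡ (trans (saturated γq e (⊥-elim ∘ e≢opp-d ∘ toward-p))
                               (sym (facing-≗ same (move d p) e)))
      where
      toward-p : move e (move d p) ≡ p → e ≡ opp d
      toward-p z≡p = move-injectiveˡ e (opp d) (move d p) (trans z≡p (sym (move-opp d p)))
    saturated′ {y} γ′y e toward | no q≢y =
      trans (saturated (trans (cong cell (sym (↦-there γ _ (q≢y ∘ sym)))) γ′y) e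
                       (λ z≡p → earlier z≡p (toward z≡p)))
            (sym (facing-≗ same y e))
      where
      earlier : move e y ≡ p → opp e ∈ d ∷ ds → opp e ∈ ds
      earlier z≡p (here refl) = ⊥-elim (q≢y (sym (move⁻¹ e z≡p)))
      earlier _ (there e∈ds) = e∈ds

  announce-many : ∀ {γ p i} → SaturatedExcept γ p [] → cell (γ p) ≡ tile i → ∀ ds →
    Σ SConf λ γ′ → (γ Net.⇒* γ′) × SaturatedExcept γ′ p ds ×
                   (shape γ′ ≗C shape γ) × (cell (γ′ p) ≡ tile i)
  announce-many saturated γp [] = _ , done ≗-refl , saturated , ≗-refl , γp
  announce-many saturated γp (d ∷ ds) with announce-many saturated γp ds
  ... | γ₁ , γ⇒*γ₁ , saturated₁ , same₁ , γ₁p with announce-saturating saturated₁ γ₁p d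
  ...   | γ₂ , γ₁⇒*γ₂ , saturated₂ , same₂ , γ₂p =
    γ₂ , γ⇒*γ₁ ◅◅ γ₁⇒*γ₂ , saturated₂ , ≗-trans same₂ same₁ , γ₂p

  announce-all : ∀ {γ p i} → SaturatedExcept γ p [] → cell (γ p) ≡ tile i →
    Σ SConf λ γ′ → (γ Net.⇒* γ′) × Saturated γ′ × (shape γ′ ≗C shape γ)
  announce-all saturated γp with announce-many saturated γp allDirs
  ... | γ′ , γ⇒*γ′ , saturated′ , same , _ =
    γ′ , γ⇒*γ′ , (λ γ′y e → saturated′ γ′y e (λ _ → ∈-allDirs (opp e))) , same

  saturated-step : ∀ {α′ α β} → Saturated α′ → shape α′ ≗C α → α ⇒ β →
    Σ SConf λ β′ → (α′ Net.⇒* β′) × Saturated β′ × (shape β′ ≗C β)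
  saturated-step {α′} saturated eq α⇒β with simulate-attach (saturated⇒sound {α′} saturated) eq α⇒β
  ... | i , β₁ , α′⇒*β₁ , upd@(β₁p , _) , shape-β₁
    with announce-all (saturatedExcept-attach saturated upd) (cell-at β₁p)
  ...   | β′ , β₁⇒*β′ , saturated′ , same =
    β′ , α′⇒*β₁ ◅◅ β₁⇒*β′ , saturated′ , ≗-trans same shape-β₁

  initial-facing : ∀ {σ y e} → Net.initConf σ → move e y ≢ origin → facing (shape σ) y e ≡ zero
  initial-facing {σ} {y} {e} (_ , σ-off) z≢o =
    facing-null {shape σ} {y} {e} (cong tileOf (cell-at (trans (σ-off _ z≢o) (sym code-empty))))

  initial-saturatedExcept : ∀ {σ} → Net.initConf σ → SaturatedExcept σ origin []
  initial-saturatedExcept init σy e away =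
    trans (initial-slot init σy e) (sym (initial-facing init (¬Any[] ∘ away)))

  initial-saturated : ∀ {σ r} → Net.initConf σ → cell (σ origin) ≡ vacant r → Saturated σ
  initial-saturated {σ} init σo {y} σy e with move e y ≟ₚ origin
  ... | yes z≡o = trans (initial-slot init σy e)
    (sym (facing-null {shape σ} {y} {e} (trans (cong (shape σ) z≡o) (cong tileOf σo))))
  ... | no z≢o = trans (initial-slot init σy e) (sym (initial-facing init z≢o))

  initial-saturation : ∀ {σ} → Net.initConf σ →
    Σ SConf λ α′ → (σ Net.⇒* α′) × Saturated α′ × (shape α′ ≗C shape σ)
  initial-saturation {σ} init with cell (σ origin) in σo
  ... | vacant _ = σ , done ≗-refl , initial-saturated init σo , ≗-refl
  ... | tile _ = announce-all (initial-saturatedExcept init) σo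

  saturated-⇒* : ∀ {α′ α γ} → Net.Reachable α′ → Saturated α′ → shape α′ ≗C α → α ⇒* γ →
    Σ SConf λ γ′ → Net.Reachable γ′ × Saturated γ′ × (shape γ′ ≗C γ)
  saturated-⇒* reach saturated eq (done α≗γ) = _ , reach , saturated , ≗-trans eq α≗γ
  saturated-⇒* reach saturated eq (step α⇒β β⇒*γ) with saturated-step saturated eq α⇒β
  ... | β′ , α′⇒*β′ , saturated′ , eq′ =
    saturated-⇒* (reachable-⇒* reach α′⇒*β′) saturated′ eq′ β⇒*γ

  σ₀ : SConf
  σ₀ = (λ _ → zero) [ origin ↦ code (toCell seedTile) ]

  σ₀-initial : Net.initConf σ₀
  σ₀-initial = ↦-updated (λ _ → zero) origin (code (toCell seedTile))

  saturated-representative : ∀ {α} → Reachable α →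
    Σ SConf λ α′ → Net.Reachable α′ × Saturated α′ × (shape α′ ≗C α)
  saturated-representative (σ , seed , σ⇒*α) with initial-saturation σ₀-initial
  ... | α₀ , σ₀⇒*α₀ , saturated₀ , eq₀ =
    saturated-⇒* (σ₀ , σ₀-initial , σ₀⇒*α₀) saturated₀
      (≗-trans eq₀ (Updated-≗ ≗-refl (initial-seed σ₀-initial) seed)) σ⇒*α

  saturated-idle : ∀ {α′} → Saturated α′ → Inert (shape α′) → ∀ β′ → α′ Net.⇒ β′ → β′ ≗C α′
  saturated-idle {α′} saturated inert β′ α′⇒β′ with step-view α′⇒β′
  ... | attaching attachment =
    ⊥-elim (inert _ (proj₂ (attach-sound (saturated⇒sound {α′} saturated) attachment)))
  ... | announcing {p} {d} {i} {r} (αp , αq , βp , βq , β≡α) = β′≗α′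
    where
    r≡ : r [ opp d ]≔ glue (suc i) d ≡ r
    r≡ = trans (cong (r [ opp d ]≔_)
                     (trans (sym (announced-facing {α′} {p} {d} αp)) (sym (saturated αq (opp d)))))
               (≔-slot r (opp d))
    β′≗α′ : β′ ≗C α′
    β′≗α′ x with x ≟ₚ p | x ≟ₚ move d p
    ... | yes refl | _ = trans βp (sym (code-at αp))
    ... | no _ | yes refl = trans βq (trans (cong (code ∘ vacant) r≡) (sym (code-at αq)))
    ... | no x≢p | no x≢q = β≡α x x≢p x≢q

  shape-inert : ∀ {α′} → Net.Terminal α′ → Inert (shape α′)
  shape-inert (reach , final) β α⇒β with simulate-step (reachable⇒sound reach) ≗-refl α⇒β
  ... | β′ , α′⇒*β′ , shape-β′ =
    ⇒-not-idle α⇒β (≗-trans (≗-sym shape-β′) (shape-≗ (final β′ α′⇒*β′)))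

  shape-terminal : ∀ {α′} → Net.Terminal α′ → Terminal (shape α′)
  shape-terminal terminal@(reach , _) =
    shape-reachable reach , stable-reachable (shape-reachable reach) ,
    λ _ → Star-stuck (shape-inert terminal)

  terminal-representative : ∀ {α} → Terminal α → Σ SConf λ α′ → Net.Terminal α′ × (shape α′ ≗C α)
  terminal-representative (reach , _ , final) with saturated-representative reach
  ... | α′ , reach′ , saturated , eq =
    α′ , (reach′ , λ β′ → Star-idle (saturated-idle saturated inert) ≗-refl) , eq
    where
    inert : Inert (shape α′)
    inert = inert-≗ (final⇒inert final) (≗-sym eq)

  representation : Sim.RepFun network Γ
  representation x = just (tileOf (cell x))

  Represents : SConf → TConf → Set
  Represents = Sim.MapsTo network Γ representation

  represents⇒≗ : ∀ {α′ α} → Represents α′ α → shape α′ ≗C α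
  represents⇒≗ rep p = just-injective (rep p)

  ≗⇒represents : ∀ {α′ α} → shape α′ ≗C α → Represents α′ α
  ≗⇒represents eq p = cong just (eq p)

  represents-reachable : ∀ {α′ α} → Net.Reachable α′ → Represents α′ α → Reachable α
  represents-reachable reach rep = reachable-≗ (shape-reachable reach) (represents⇒≗ rep)

  reachable-represented : ∀ {α} → Reachable α → Σ SConf λ α′ → Net.Reachable α′ × Represents α′ α
  reachable-represented reach with saturated-representative reach
  ... | α′ , reach′ , _ , eq = α′ , reach′ , ≗⇒represents eq

  represents-terminal : ∀ {α′} → Net.Terminal α′ → Σ TConf λ α → Represents α′ α × Terminal α
  represents-terminal {α′} terminal = shape α′ , ≗⇒represents ≗-refl , shape-terminal terminal

  terminal-represented : ∀ {α} → Terminal α → Σ SConf λ α′ → Net.Terminal α′ × Represents α′ α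
  terminal-represented terminal with terminal-representative terminal
  ... | α′ , terminal′ , eq = α′ , terminal′ , ≗⇒represents eq

  represents-step : ∀ {α′ β′ α β} → Net.Reachable α′ → α′ Net.⇒ β′ →
    Represents α′ α → Represents β′ β → α ⇒⁼ β
  represents-step reach α′⇒β′ rep-α rep-β =
    ⇒⁼-resp (represents⇒≗ rep-α) (represents⇒≗ rep-β) (proj₂ (sound-⇒ (reachable⇒sound reach) α′⇒β′))

  represents-simulate : ∀ {α′ α β} → Net.Reachable α′ → Represents α′ α → α ⇒ β →
    Σ SConf λ β′ → (α′ Net.⇒* β′) × Represents β′ β
  represents-simulate reach rep α⇒β with simulate-step (reachable⇒sound reach) (represents⇒≗ rep) α⇒β
  ... | β′ , α′⇒*β′ , eq = β′ , α′⇒*β′ , ≗⇒represents eq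

-- Π is the set of all reachable representatives, which makes condition (3b) immediate.
theorem2 : (Γ : aTAM) → Σ sCRN λ Γ' → UnitSeeded Γ' × SimulatesSys Γ' Γ
theorem2 Γ = network , network-unitSeeded , representation ,
    (λ _ reach _ → represents-reachable reach)
  , (λ _ → reachable-represented)
  , (λ _ → represents-terminal)
  , (λ _ → terminal-represented)
  , (λ _ _ reach _ α′⇒β′ _ _ → represents-step reach α′⇒β′)
  , λ α reach →
      (λ α′ → Net.Reachable α′ × Represents α′ α) , reachable-represented reach , (λ _ r → r) ,
      λ _ _ α⇒β →
        (λ _ (reach′ , rep) → represents-simulate reach′ rep α⇒β) ,
        (λ α″ reach″ rep _ → α″ , (reach″ , rep) , done ≗-refl)
  where open Construction Γ
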